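{- Let $n > 4$ be an integer and let $\Gamma = Q_n^2$ be the square of the hypercube $Q_n$. Then $\mathrm{Aut}(\Gamma) \cong \mathbb{Z}_2^n \rtimes \mathrm{Sym}([n+1])$.
   Context: All graphs are finite, simple and undirected. The hypercube $Q_n$ is the graph with vertex set $\{0,1\}^n$ in which two $n$-tuples are adjacent if and only if they differ in precisely one coordinate. For a graph $\Gamma=(V,E)$, the square $\Gamma^2$ is the simple graph with vertex set $V$ in which two distinct vertices are adjacent if and only if their distance in $\Gamma$ is at most two. $\mathrm{Aut}(\Gamma)$ denotes the automorphism group of a graph $\Gamma$ (adjacency-preserving permutations of the vertex set under composition). $[m]=\{1,\dots,m\}$, $\mathrm{Sym}([m])$ is the group of all permutations of $[m]$, and $\mathbb{Z}_2$ is the cyclic group of order 2. A group $G$ is called a semidirect product of $N$ by $Q$, denoted $G = N \rtimes Q$, if $G$ contains subgroups $N$ and $Q$ such that (i) $N$ is normal in $G$, (ii) $NQ = G$, and (iii) $N\cap Q = 1$. Thus $\mathrm{Aut}(\Gamma) \cong \mathbb{Z}_2^n \rtimes \mathrm{Sym}([n+1])$ means that $\mathrm{Aut}(\Gamma)$ is a semidirect product, in this sense, of a subgroup isomorphic to $\mathbb{Z}_2^n$ by a subgroup isomorphic to $\mathrm{Sym}([n+1])$. -}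

module Defs where

open import Algebra.Bundles using (Group; CommutativeRing)
import Algebra.Construct.Pointwise as Pointwise
open import Algebra.Morphism.Structures using (module GroupMorphisms)
open import Data.Bool.Base using (Bool)
open import Data.Bool.Properties using (xor-∧-commutativeRing)
open import Data.Fin.Base using (Fin; zero)
open import Data.Fin.Properties using (*↔×; 2↔Bool)
open import Data.Nat.Base using (ℕ; zero; suc; _≤_; _*_; _^_)
open import Data.Product.Base using (Σ; ∃; ∃-syntax; ∃₂; _×_; _,_; proj₁)
open import Data.Product using (∃!)
open import Data.Product.Function.NonDependent.Propositional using (_×-↔_)
open import Data.Vec.Base using (Vec; []; _∷_; lookup)
open import Function.Base using (_∘_)
open import Function.Bundles using (_↔_; _⇔_; mk↔ₛ′; mk⇔; Inverse)
open import Function.Construct.Composition using (_↔-∘_; _⇔-∘_)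
open import Function.Construct.Identity using (↔-id; ⇔-id)
open import Function.Construct.Symmetry using (↔-sym; ⇔-sym)
open import Level using (Level; 0ℓ; _⊔_) renaming (suc to lsuc)
open import Relation.Binary.PropositionalEquality
  using (_≡_; _≢_; refl; sym; trans; cong; subst₂)
open import Relation.Nullary using (¬_)
open import Relation.Unary using (Pred)

record Graph : Set₁ where
  infix 4 _~_
  field
    V        : Set
    _~_      : V → V → Set
    finite   : ∃[ k ] (V ↔ Fin k)
    ~-sym    : ∀ {u v} → u ~ v → v ~ u
    ~-irrefl : ∀ {v} → ¬ (v ~ v)

module _ (Γ : Graph) where
  open Graph Γ

  data Walk : V → V → ℕ → Set where
    []  : ∀ {v} → Walk v v 0
    _∷_ : ∀ {u v w k} → u ~ v → Walk v w k → Walk u w (suc k)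

  -- The distance is kept as a relation because it is undefined between
  -- different connected components.
  IsDistance : V → V → ℕ → Set
  IsDistance u v d = Walk u v d × (∀ {k} → Walk u v k → d ≤ k)

module _ {Γ : Graph} where
  open Graph Γ

  private
    snoc : ∀ {u v w k} → Walk Γ u v k → v ~ w → Walk Γ u w (suc k)
    snoc []      f = f ∷ []
    snoc (e ∷ p) f = e ∷ snoc p f

  reverse : ∀ {u v k} → Walk Γ u v k → Walk Γ v u k
  reverse []      = []
  reverse (e ∷ p) = snoc (reverse p) (~-sym e)

  IsDistance-sym : ∀ {u v d} → IsDistance Γ u v d → IsDistance Γ v u d
  IsDistance-sym (p , min) = reverse p , λ q → min (reverse q)

infix 8 _²

_² : Graph → Graph
Γ ² = record
  { V        = V
  ; _~_      = λ u v → u ≢ v × ∃[ d ] (IsDistance Γ u v d × d ≤ 2)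
  ; finite   = finite
  ; ~-sym    = λ (u≢v , d , δ , d≤2) →
                 (λ v≡u → u≢v (sym v≡u)) , d , IsDistance-sym δ , d≤2
  ; ~-irrefl = λ (v≢v , _) → v≢v refl
  }
  where open Graph Γ

private
  Vec-finite : ∀ n → Vec Bool n ↔ Fin (2 ^ n)
  Vec-finite zero    = mk↔ₛ′ (λ _ → zero) (λ _ → [])
                         (λ { zero → refl }) (λ { [] → refl })
  Vec-finite (suc n) =
    ↔-sym *↔× ↔-∘ ((↔-sym 2↔Bool ×-↔ Vec-finite n) ↔-∘ uncons)
    where
    uncons : Vec Bool (suc n) ↔ (Bool × Vec Bool n)
    uncons = mk↔ₛ′ (λ { (b ∷ bs) → b , bs }) (λ (b , bs) → b ∷ bs)
               (λ _ → refl) (λ { (b ∷ bs) → refl })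

Q : ℕ → Graph
Q n = record
  { V        = Vec Bool n
  ; _~_      = λ u v → ∃! _≡_ λ i → lookup u i ≢ lookup v i
  ; finite   = 2 ^ n , Vec-finite n
  ; ~-sym    = λ (i , uᵢ≢vᵢ , unique) →
                 i , uᵢ≢vᵢ ∘ sym , λ vⱼ≢uⱼ → unique (vⱼ≢uⱼ ∘ sym)
  ; ~-irrefl = λ (i , vᵢ≢vᵢ , _) → vᵢ≢vᵢ refl
  }

-- Multiplication is composition of functions, (f ∙ g) x = f (g x), and two
-- permutations are equal when they agree pointwise.
Sym : Set → Group 0ℓ 0ℓ
Sym A = record
  { Carrier = A ↔ A
  ; _≈_     = λ f g → ∀ x → to f x ≡ to g x
  ; _∙_     = λ f g → f ↔-∘ g
  ; ε       = ↔-id A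
  ; _⁻¹     = ↔-sym
  ; isGroup = record
    { isMonoid = record
      { isSemigroup = record
        { isMagma = record
          { isEquivalence = record
            { refl  = λ _ → refl
            ; sym   = λ f≈g x → sym (f≈g x)
            ; trans = λ f≈g g≈h x → trans (f≈g x) (g≈h x)
            }
          ; ∙-cong = λ {f} {g} {h} {k} f≈g h≈k x →
              trans (cong (to f) (h≈k x)) (f≈g (to k x))
          }
        ; assoc = λ _ _ _ _ → refl
        }
      ; identity = (λ _ _ → refl) , (λ _ _ → refl)
      }
    ; inverse = strictlyInverseʳ , strictlyInverseˡ
    ; ⁻¹-cong = λ {f} {g} f≈g x →
        trans (cong (from f) (sym (strictlyInverseˡ g x)))
          (trans (cong (from f) (sym (f≈g (from g x))))
            (strictlyInverseʳ f (from g x)))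
    }
  }
  where open Inverse

record Subgroup {c ℓ} (G : Group c ℓ) (p : Level) : Set (c ⊔ ℓ ⊔ lsuc p) where
  open Group G
  field
    Member    : Pred Carrier p
    resp      : ∀ {x y} → x ≈ y → Member x → Member y
    ∙-closed  : ∀ {x y} → Member x → Member y → Member (x ∙ y)
    ε-closed  : Member ε
    ⁻¹-closed : ∀ {x} → Member x → Member (x ⁻¹)

  group : Group (c ⊔ p) ℓ
  group = record
    { Carrier = Σ Carrier Member
    ; _≈_     = λ x y → proj₁ x ≈ proj₁ y
    ; _∙_     = λ (x , x∈) (y , y∈) → x ∙ y , ∙-closed x∈ y∈
    ; ε       = ε , ε-closed
    ; _⁻¹     = λ (x , x∈) → x ⁻¹ , ⁻¹-closed x∈
    ; isGroup = record
      { isMonoid = record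
        { isSemigroup = record
          { isMagma = record
            { isEquivalence = record
              { refl = Group.refl G ; sym = Group.sym G ; trans = Group.trans G }
            ; ∙-cong = ∙-cong
            }
          ; assoc = λ _ _ _ → assoc _ _ _
          }
        ; identity = (λ _ → identityˡ _) , (λ _ → identityʳ _)
        }
      ; inverse = (λ _ → inverseˡ _) , (λ _ → inverseʳ _)
      ; ⁻¹-cong = ⁻¹-cong
      }
    }

Aut : Graph → Group 0ℓ 0ℓ
Aut Γ = Subgroup.group automorphisms
  where
  open Graph Γ
  open Inverse
  automorphisms : Subgroup (Sym V) 0ℓ
  automorphisms = record
    { Member    = λ f → ∀ u v → u ~ v ⇔ to f u ~ to f v
    ; resp      = λ f≈g p u v →
        mk⇔ (subst₂ _~_ (f≈g u) (f≈g v)) (subst₂ _~_ (sym (f≈g u)) (sym (f≈g v)))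
          ⇔-∘ p u v
    ; ∙-closed  = λ {_} {g} p q u v → p (to g u) (to g v) ⇔-∘ q u v
    ; ε-closed  = λ u v → ⇔-id (u ~ v)
    ; ⁻¹-closed = λ {f} p u v →
        ⇔-sym (p (from f u) (from f v)) ⇔-∘
        mk⇔ (subst₂ _~_ (sym (strictlyInverseˡ f u)) (sym (strictlyInverseˡ f v)))
            (subst₂ _~_ (strictlyInverseˡ f u) (strictlyInverseˡ f v))
    }

ℤ₂ : Group 0ℓ 0ℓ
ℤ₂ = CommutativeRing.+-group xor-∧-commutativeRing

infix 8 _^ᴳ_

_^ᴳ_ : Group 0ℓ 0ℓ → ℕ → Group 0ℓ 0ℓ
G ^ᴳ n = Pointwise.group (Fin n) G

infix 4 _≅_ _≅_⋊_

_≅_ : ∀ {c₁ ℓ₁ c₂ ℓ₂} → Group c₁ ℓ₁ → Group c₂ ℓ₂ → Set (c₁ ⊔ ℓ₁ ⊔ c₂ ⊔ ℓ₂)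
G ≅ H = ∃ IsGroupIsomorphism
  where open GroupMorphisms (Group.rawGroup G) (Group.rawGroup H)

record IsSemidirectProduct {c ℓ p q} (G : Group c ℓ)
         (N : Subgroup G p) (K : Subgroup G q) : Set (c ⊔ ℓ ⊔ p ⊔ q) where
  open Group G
  private
    module N = Subgroup N
    module K = Subgroup K
  field
    normal  : ∀ g {x} → N.Member x → N.Member ((g ∙ x) ∙ g ⁻¹)
    product : ∀ g → ∃₂ λ x y → N.Member x × K.Member y × g ≈ x ∙ y
    trivial : ∀ {x} → N.Member x → K.Member x → x ≈ ε

-- The action is not part of the data: some internal semidirect
-- decomposition of G has factors isomorphic to A and B.
_≅_⋊_ : Group 0ℓ 0ℓ → Group 0ℓ 0ℓ → Group 0ℓ 0ℓ → Set₁
G ≅ A ⋊ B =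
  Σ (Subgroup G 0ℓ) λ N → Σ (Subgroup G 0ℓ) λ K →
    IsSemidirectProduct G N K × Subgroup.group N ≅ A × Subgroup.group K ≅ B

{-# OPTIONS --safe #-}
module Submission where

-- Put f₀ = 0 and fᵢ = eᵢ.  In the square of the hypercube u and v are adjacent
-- iff u ⊕ v = fᵢ ⊕ fⱼ with i ≠ j.  A 4-clique whose sum is zero is a maximal
-- clique, while any other 4-clique consists of the points y ⊕ fᵢ for a fixed y
-- and four values of i, and extends since n + 1 > 4.  So an automorphism g
-- preserves 4-cliques of sum zero, which says that
-- A x i j = g x ⊕ g (x ⊕ fᵢ ⊕ fⱼ) is a cocycle in i, j.  Then A does not depend
-- on x, and g is affine.  Its linear part maps the pairwise adjacent vectors
-- fᵢ ⊕ f₀ to a star, so it is induced by a permutation σ of the fᵢ; hence g is a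
-- translation after a permutation.

open import Defs
open import Algebra.Bundles using (CommutativeRing; CommutativeSemigroup; Group)
import Algebra.Properties.CommutativeSemigroup as CommutativeSemigroupProperties
open import Data.Bool.Base using (Bool; true; false; _xor_)
open import Data.Bool.Properties using (xor-assoc; xor-comm; xor-identityˡ; xor-identityʳ; xor-same)
import Data.Bool.Properties as Bool
open import Data.Empty using (⊥)
open import Data.Fin.Base using (Fin; zero; suc)
open import Data.Fin.Patterns using (0F; 1F; 2F; 3F)
open import Data.Fin.Properties using (_≟_; any?; all?; ¬∀⟶∃¬; injective⇒≤)
open import Data.Nat.Base using (ℕ; suc; _>_; _<_; _≤_; z≤n; s≤s)
import Data.Nat.Properties as ℕ
open import Data.Product.Base using (Σ; ∃₂; ∃-syntax; _×_; _,_; proj₁; proj₂)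
open import Data.Sum.Base using (_⊎_; inj₁; inj₂)
open import Data.Vec.Base using (Vec; []; _∷_; lookup; zipWith; replicate; tabulate)
import Data.Vec.Properties as Vec
open import Function.Base using (_∘_; id)
open import Function.Bundles using (_↔_; _⇔_; mk↔ₛ′; mk⇔; Inverse; Equivalence)
open import Function.Construct.Composition using (_↔-∘_)
open import Function.Construct.Identity using (↔-id)
open import Function.Construct.Symmetry using (↔-sym)
open import Level using (0ℓ)
open import Relation.Binary.PropositionalEquality
open import Relation.Nullary using (¬_; yes; no; does; contradiction)
open import Relation.Nullary.Decidable using (dec-true; dec-false; decidable-stable; ¬?)

open ≡-Reasoning

private variable
  n k : ℕ

-- The `𝔽₂`-vector space of points and its linear maps.

infixl 6 _⊕_

_⊕_ : Vec Bool n → Vec Bool n → Vec Bool n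
_⊕_ = zipWith _xor_

𝟘 : Vec Bool n
𝟘 = replicate _ false

e : Fin n → Vec Bool n
e zero    = true ∷ 𝟘
e (suc i) = false ∷ e i

⊕-assoc : (x y z : Vec Bool n) → (x ⊕ y) ⊕ z ≡ x ⊕ (y ⊕ z)
⊕-assoc = Vec.zipWith-assoc xor-assoc

⊕-comm : (x y : Vec Bool n) → x ⊕ y ≡ y ⊕ x
⊕-comm = Vec.zipWith-comm xor-comm

⊕-identityˡ : (x : Vec Bool n) → 𝟘 ⊕ x ≡ x
⊕-identityˡ = Vec.zipWith-identityˡ xor-identityˡ

⊕-identityʳ : (x : Vec Bool n) → x ⊕ 𝟘 ≡ x
⊕-identityʳ = Vec.zipWith-identityʳ xor-identityʳ

⊕-self : (x : Vec Bool n) → x ⊕ x ≡ 𝟘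
⊕-self []      = refl
⊕-self (b ∷ x) = cong₂ _∷_ (xor-same b) (⊕-self x)

⊕-commutativeSemigroup : ℕ → CommutativeSemigroup _ _
⊕-commutativeSemigroup n = record
  { Carrier = Vec Bool n
  ; _≈_     = _≡_
  ; _∙_     = _⊕_
  ; isCommutativeSemigroup = record
    { isSemigroup = record
      { isMagma = record { isEquivalence = isEquivalence ; ∙-cong = cong₂ _⊕_ }
      ; assoc   = ⊕-assoc
      }
    ; comm = ⊕-comm
    }
  }

-- The linear extension of `h` from the standard basis, used both for linear parts of automorphisms
-- and as the evaluation map of the solver.
lin : (Fin k → Vec Bool n) → Vec Bool k → Vec Bool n
lin h []          = 𝟘
lin h (false ∷ x) = lin (h ∘ suc) x
lin h (true  ∷ x) = h zero ⊕ lin (h ∘ suc) x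

lin-𝟘 : (h : Fin k → Vec Bool n) → lin h 𝟘 ≡ 𝟘
lin-𝟘 {0}     h = refl
lin-𝟘 {suc k} h = lin-𝟘 (h ∘ suc)

lin-e : (h : Fin k → Vec Bool n) (i : Fin k) → lin h (e i) ≡ h i
lin-e h zero    = trans (cong (h zero ⊕_) (lin-𝟘 (h ∘ suc))) (⊕-identityʳ (h zero))
lin-e h (suc i) = lin-e (h ∘ suc) i

lin-⊕ : (h : Fin k → Vec Bool n) (x y : Vec Bool k) → lin h (x ⊕ y) ≡ lin h x ⊕ lin h y
lin-⊕ h []          []          = sym (⊕-self 𝟘)
lin-⊕ h (false ∷ x) (false ∷ y) = lin-⊕ (h ∘ suc) x y
lin-⊕ {n = n} h (false ∷ x) (true ∷ y) =
  trans (cong (h zero ⊕_) (lin-⊕ (h ∘ suc) x y)) (x∙yz≈y∙xz _ _ _)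
  where open CommutativeSemigroupProperties (⊕-commutativeSemigroup n)
lin-⊕ h (true ∷ x) (false ∷ y) =
  trans (cong (h zero ⊕_) (lin-⊕ (h ∘ suc) x y)) (sym (⊕-assoc _ _ _))
lin-⊕ {n = n} h (true ∷ x) (true ∷ y) = begin
  lin t (x ⊕ y)                            ≡⟨ lin-⊕ t x y ⟩
  lin t x ⊕ lin t y                        ≡⟨ ⊕-identityˡ _ ⟨
  𝟘 ⊕ (lin t x ⊕ lin t y)                  ≡⟨ cong (_⊕ (lin t x ⊕ lin t y)) (⊕-self (h zero)) ⟨
  (h zero ⊕ h zero) ⊕ (lin t x ⊕ lin t y)  ≡⟨ interchange _ _ _ _ ⟩
  (h zero ⊕ lin t x) ⊕ (h zero ⊕ lin t y)  ∎
  where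
  open CommutativeSemigroupProperties (⊕-commutativeSemigroup n)
  t = h ∘ suc

lin-cong : {h h′ : Fin k → Vec Bool n} → (∀ i → h i ≡ h′ i) → ∀ x → lin h x ≡ lin h′ x
lin-cong eq []          = refl
lin-cong eq (false ∷ x) = lin-cong (eq ∘ suc) x
lin-cong eq (true  ∷ x) = cong₂ _⊕_ (eq zero) (lin-cong (eq ∘ suc) x)

-- Linear identities by reflection.

infixl 6 _:+_

data Expr (k : ℕ) : Set where
  var  : Fin k → Expr k
  _:+_ : Expr k → Expr k → Expr k
  :0   : Expr k

⟦_⟧ : Expr k → (Fin k → Vec Bool n) → Vec Bool n
⟦ var i  ⟧ ρ = ρ i
⟦ s :+ t ⟧ ρ = ⟦ s ⟧ ρ ⊕ ⟦ t ⟧ ρ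
⟦ :0     ⟧ ρ = 𝟘

-- Interpreting the variables as the standard basis computes a normal form. It is a closed vector
-- for a concrete expression, so two of them compare by `refl`.
coefficients : Expr k → Vec Bool k
coefficients s = ⟦ s ⟧ e

lin-coefficients : (s : Expr k) (ρ : Fin k → Vec Bool n) → lin ρ (coefficients s) ≡ ⟦ s ⟧ ρ
lin-coefficients (var i)  ρ = lin-e ρ i
lin-coefficients (s :+ t) ρ = trans (lin-⊕ ρ (coefficients s) (coefficients t))
                                (cong₂ _⊕_ (lin-coefficients s ρ) (lin-coefficients t ρ))
lin-coefficients :0       ρ = lin-𝟘 ρ

-- Identities in the 𝔽₂-vector space of points hold as soon as both sides have
-- the same coefficients.
solve : (ρ : Vec (Vec Bool n) k) (s t : Expr k) → coefficients s ≡ coefficients t →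
        ⟦ s ⟧ (lookup ρ) ≡ ⟦ t ⟧ (lookup ρ)
solve ρ s t eq = begin
  ⟦ s ⟧ (lookup ρ)                   ≡⟨ lin-coefficients s (lookup ρ) ⟨
  lin (lookup ρ) (coefficients s)    ≡⟨ cong (lin (lookup ρ)) eq ⟩
  lin (lookup ρ) (coefficients t)    ≡⟨ lin-coefficients t (lookup ρ) ⟩
  ⟦ t ⟧ (lookup ρ)                   ∎

pattern v₀ = var 0F
pattern v₁ = var 1F
pattern v₂ = var 2F
pattern v₃ = var 3F

-- Cancellation and induction over the cube.

⊕-cancelˡ : (x : Vec Bool n) {y z : Vec Bool n} → x ⊕ y ≡ x ⊕ z → y ≡ z
⊕-cancelˡ x {y} {z} eq = begin
  y            ≡⟨ solve (x ∷ y ∷ []) v₁ (v₀ :+ (v₀ :+ v₁)) refl ⟩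
  x ⊕ (x ⊕ y)  ≡⟨ cong (x ⊕_) eq ⟩
  x ⊕ (x ⊕ z)  ≡⟨ solve (x ∷ z ∷ []) (v₀ :+ (v₀ :+ v₁)) v₁ refl ⟩
  z            ∎

⊕≡𝟘⇒≡ : (x y : Vec Bool n) → x ⊕ y ≡ 𝟘 → x ≡ y
⊕≡𝟘⇒≡ x y eq = sym (⊕-cancelˡ x (trans eq (sym (⊕-self x))))

-- Points with head `false` form a smaller cube; a point with head `true` is one step in direction
-- `e zero` away from it.
cube-induction : (P : Vec Bool n → Set) → P 𝟘 → (∀ x i → P x → P (x ⊕ e i)) → ∀ x → P x
cube-induction P p₀ step []          = p₀
cube-induction P p₀ step (false ∷ x) =
  cube-induction (P ∘ (false ∷_)) p₀ (λ y i → step (false ∷ y) (suc i)) x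
cube-induction P p₀ step (true ∷ x)  = subst P (cong (true ∷_) (⊕-identityʳ x))
  (step (false ∷ x) zero
    (cube-induction (P ∘ (false ∷_)) p₀ (λ y i → step (false ∷ y) (suc i)) x))

-- The n + 1 points f i are affinely independent, and u, v are adjacent in
-- (Q n) ² exactly when u ⊕ v = f i ⊕ f j for some i ≠ j; permuting them gives
-- the factor Sym (Fin (suc n)).
f : Fin (suc n) → Vec Bool n
f zero    = 𝟘
f (suc i) = e i

-- Characters separating the indices.

parity : Vec Bool n → Bool
parity []      = false
parity (b ∷ x) = b xor parity x

-- χ k is the additive character with χ k (f i ⊕ f j) = δ k i xor δ k j.
χ : Fin (suc n) → Vec Bool n → Bool
χ zero    = parity
χ (suc i) x = lookup x i

lookup-e : (i j : Fin n) → lookup (e j) i ≡ does (i ≟ j)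
lookup-e zero    zero    = refl
lookup-e (suc i) zero    = Vec.lookup-replicate i false
lookup-e zero    (suc j) = refl
lookup-e (suc i) (suc j) = lookup-e i j

parity-𝟘 : ∀ n → parity (𝟘 {n}) ≡ false
parity-𝟘 0       = refl
parity-𝟘 (suc n) = parity-𝟘 n

parity-e : (i : Fin n) → parity (e i) ≡ true
parity-e {suc n} zero = cong (true xor_) (parity-𝟘 n)
parity-e (suc i)      = parity-e i

parity-⊕ : (x y : Vec Bool n) → parity (x ⊕ y) ≡ parity x xor parity y
parity-⊕ []      []      = refl
parity-⊕ (a ∷ x) (b ∷ y) = trans (cong ((a xor b) xor_) (parity-⊕ x y))
                             (interchange a b (parity x) (parity y))
  where
  open CommutativeSemigroupProperties
    (CommutativeRing.+-commutativeSemigroup Bool.xor-∧-commutativeRing)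

χ-⊕ : (k : Fin (suc n)) (x y : Vec Bool n) → χ k (x ⊕ y) ≡ χ k x xor χ k y
χ-⊕ zero    x y = parity-⊕ x y
χ-⊕ (suc i) x y = Vec.lookup-zipWith _xor_ i x y

χ-f⊕f : (k i j : Fin (suc n)) → χ k (f i ⊕ f j) ≡ does (k ≟ i) xor does (k ≟ j)
χ-f⊕f {n} zero i j = trans (parity-⊕ (f i) (f j)) (lemma i j)
  where
  -- `parity (f i)` is the negation of `does (zero ≟ i)`; the two negations cancel under `xor`.
  lemma : (i j : Fin (suc n)) → parity (f i) xor parity (f j) ≡ does (zero ≟ i) xor does (zero ≟ j)
  lemma zero    zero    rewrite parity-𝟘 n = refl
  lemma zero    (suc j) rewrite parity-𝟘 n | parity-e j = refl
  lemma (suc i) zero    rewrite parity-𝟘 n | parity-e i = refl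
  lemma (suc i) (suc j) rewrite parity-e i | parity-e j = refl
χ-f⊕f {n} (suc k) i j = trans (Vec.lookup-zipWith _xor_ k (f i) (f j)) (cong₂ _xor_ (lemma i) (lemma j))
  where
  lemma : (i : Fin (suc n)) → lookup (f i) k ≡ does (suc k ≟ i)
  lemma zero    = Vec.lookup-replicate k false
  lemma (suc i) = lookup-e k i

χ-self : {i j : Fin (suc n)} → i ≢ j → χ i (f i ⊕ f j) ≡ true
χ-self {i = i} {j} i≢j = trans (χ-f⊕f i i j)
  (cong₂ _xor_ (dec-true (i ≟ i) refl) (dec-false (i ≟ j) i≢j))

χ-other : {k i j : Fin (suc n)} → k ≢ i → k ≢ j → χ k (f i ⊕ f j) ≡ false
χ-other {k = k} {i} {j} k≢i k≢j = trans (χ-f⊕f k i j)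
  (cong₂ _xor_ (dec-false (k ≟ i) k≢i) (dec-false (k ≟ j) k≢j))

true≢false : true ≢ false
true≢false ()

χ-true : {k i j : Fin (suc n)} → χ k (f i ⊕ f j) ≡ true → k ≡ i ⊎ k ≡ j
χ-true {k = k} {i} {j} t with k ≟ i | k ≟ j
... | yes k≡i | _       = inj₁ k≡i
... | no _    | yes k≡j = inj₂ k≡j
... | no k≢i  | no k≢j  = contradiction (trans (sym t) (χ-other k≢i k≢j)) true≢false

-- `χ i` is true on the left side, and on `f k ⊕ f l` only `χ k` and `χ l` can be true.
f⊕f-endpoint : {i j k l : Fin (suc n)} → i ≢ j → f i ⊕ f j ≡ f k ⊕ f l → i ≡ k ⊎ i ≡ l
f⊕f-endpoint {i = i} i≢j eq = χ-true (trans (cong (χ i) (sym eq)) (χ-self i≢j))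

-- The neighbours f p ⊕ f t of 𝟘 stand for the pairs {p , t}; Has p x says that
-- the pair x contains p.
Has : Fin (suc n) → Vec Bool n → Set
Has p x = ∃[ t ] (p ≢ t × x ≡ f p ⊕ f t)

S : Vec Bool n → Set
S x = ∃[ p ] Has p x

f-pair : {i j : Fin (suc n)} → i ≢ j → S (f i ⊕ f j)
f-pair i≢j = _ , _ , i≢j , refl

¬S-𝟘 : ¬ S (𝟘 {n})
¬S-𝟘 (i , j , i≢j , eq) = true≢false (begin
  true                     ≡⟨ χ-self i≢j ⟨
  χ i (f i ⊕ f j)          ≡⟨ cong (χ i) eq ⟨
  χ i 𝟘                    ≡⟨ cong (χ i) (⊕-self 𝟘) ⟨
  χ i (𝟘 ⊕ 𝟘)              ≡⟨ χ-⊕ i 𝟘 𝟘 ⟩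
  χ i 𝟘 xor χ i 𝟘          ≡⟨ xor-same (χ i 𝟘) ⟩
  false                    ∎)

S⇒≢ : {x y : Vec Bool n} → S (x ⊕ y) → x ≢ y
S⇒≢ {x = x} s refl = ¬S-𝟘 (subst S (⊕-self x) s)

-- Cliques through the origin.

three-in-two : {A : Set} {x y z a b : A} → x ≢ y → x ≢ z → y ≢ z →
               x ≡ a ⊎ x ≡ b → y ≡ a ⊎ y ≡ b → z ≡ a ⊎ z ≡ b → ⊥
three-in-two x≢y x≢z y≢z (inj₁ refl) (inj₁ refl) _           = x≢y refl
three-in-two x≢y x≢z y≢z (inj₁ refl) (inj₂ refl) (inj₁ refl) = x≢z refl
three-in-two x≢y x≢z y≢z (inj₁ refl) (inj₂ refl) (inj₂ refl) = y≢z refl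
three-in-two x≢y x≢z y≢z (inj₂ refl) (inj₂ refl) _           = x≢y refl
three-in-two x≢y x≢z y≢z (inj₂ refl) (inj₁ refl) (inj₂ refl) = x≢z refl
three-in-two x≢y x≢z y≢z (inj₂ refl) (inj₁ refl) (inj₁ refl) = y≢z refl

-- Adjacent pairs share a point: for four distinct indices `i`, `j`, `p`, `t` the characters of `i`,
-- `j` and `p` would all be true on the sum, but a sum `f a ⊕ f b` leaves room for only two.
meets : {i j : Fin (suc n)} {w : Vec Bool n} → i ≢ j → S w → S ((f i ⊕ f j) ⊕ w) → Has i w ⊎ Has j w
meets {i = i} {j} i≢j (p , t , p≢t , refl) (a , b , _ , eq) with i ≟ p | i ≟ t | j ≟ p | j ≟ t
... | yes refl | _ | _ | _ = inj₁ (t , p≢t , refl)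
... | no _ | yes refl | _ | _ = inj₁ (p , p≢t ∘ sym , ⊕-comm (f p) (f t))
... | no _ | no _ | yes refl | _ = inj₂ (t , p≢t , refl)
... | no _ | no _ | no _ | yes refl = inj₂ (p , p≢t ∘ sym , ⊕-comm (f p) (f t))
... | no i≢p | no i≢t | no j≢p | no j≢t =
  contradiction (endpoint p (χ-other (i≢p ∘ sym) (j≢p ∘ sym)) (χ-self p≢t) refl)
    (three-in-two i≢j i≢p j≢p
      (endpoint i (χ-self i≢j) (χ-other i≢p i≢t) refl)
      (endpoint j (trans (cong (χ j) (⊕-comm (f i) (f j))) (χ-self (i≢j ∘ sym))) (χ-other j≢p j≢t) refl))
  where
  endpoint : ∀ k {c d} → χ k (f i ⊕ f j) ≡ c → χ k (f p ⊕ f t) ≡ d →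
             c xor d ≡ true → k ≡ a ⊎ k ≡ b
  endpoint k u v h = χ-true
    (trans (trans (cong (χ k) (sym eq)) (trans (χ-⊕ k _ _) (cong₂ _xor_ u v))) h)

has-both : {p q : Fin (suc n)} {x : Vec Bool n} → p ≢ q → Has p x → Has q x → x ≡ f p ⊕ f q
has-both {p = p} p≢q (t , p≢t , refl) (_ , q≢u , eq)
  with f⊕f-endpoint {k = p} {l = t} q≢u (sym eq)
... | inj₁ q≡p  = contradiction (sym q≡p) p≢q
... | inj₂ refl = refl

common-point : {a b : Vec Bool n} → S a → S b → S (a ⊕ b) → ∃[ p ] Has p a × Has p b
common-point (p , t , p≢t , refl) Sb Sab with meets p≢t Sb Sab
... | inj₁ p∈b = p , (t , p≢t , refl) , p∈b
... | inj₂ t∈b = t , (p , p≢t ∘ sym , ⊕-comm (f p) (f t)) , t∈b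

-- Let `a` be the pair of `p` and `q`, and `b` the pair of `p` and `r`. A pair meeting both without
-- containing `p` is the pair of `q` and `r`, which closes a triangle of sum zero.
star : {p : Fin (suc n)} {a b c : Vec Bool n} → Has p a → Has p b → S c →
       S (a ⊕ b) → S (a ⊕ c) → S (b ⊕ c) → (a ⊕ b) ⊕ c ≢ 𝟘 → Has p c
star {p = p} (q , p≢q , refl) (r , p≢r , refl) Sc Sab Sac Sbc abc≢𝟘
  with meets p≢q Sc Sac | meets p≢r Sc Sbc
... | inj₁ p∈c | _        = p∈c
... | inj₂ _   | inj₁ p∈c = p∈c
... | inj₂ q∈c | inj₂ r∈c = contradiction
  (trans (cong (((f p ⊕ f q) ⊕ (f p ⊕ f r)) ⊕_) (has-both q≢r q∈c r∈c))
         (solve (f p ∷ f q ∷ f r ∷ []) (((v₀ :+ v₁) :+ (v₀ :+ v₂)) :+ (v₁ :+ v₂)) :0 refl))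
  abc≢𝟘
  where
  q≢r : q ≢ r
  q≢r refl = S⇒≢ Sab refl

-- Pigeonhole: if every `t` occurred in `xs`, choosing a position for each would embed `Fin m` into
-- `Fin k`.
fresh : ∀ {m} → k < m → (xs : Vec (Fin m) k) → ∃[ t ] (∀ i → lookup xs i ≢ t)
fresh {k} {m} k<m xs with any? (λ t → all? (λ i → ¬? (lookup xs i ≟ t)))
... | yes t = t
... | no ¬t = contradiction (injective⇒≤ position-injective) (ℕ.<⇒≱ k<m)
  where
  hit : ∀ t → ∃[ i ] ¬ ¬ (lookup xs i ≡ t)
  hit t = ¬∀⟶∃¬ k _ (λ i → ¬? (lookup xs i ≟ t)) (λ h → ¬t (t , h))
  position : Fin m → Fin k
  position = proj₁ ∘ hit
  lookup-position : ∀ t → lookup xs (position t) ≡ t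
  lookup-position t = decidable-stable (lookup xs (position t) ≟ t) (proj₂ (hit t))
  position-injective : ∀ {s t} → position s ≡ position t → s ≡ t
  position-injective {s} {t} eq =
    trans (sym (lookup-position s)) (trans (cong (lookup xs) eq) (lookup-position t))

-- The pairs `a`, `b`, `c` form a star at some `p` and occupy four indices. A fifth index `t` gives
-- one more spoke `f p ⊕ f t`, adjacent to `𝟘` and to all three.
clique-extends : 4 < suc n → {a b c : Vec Bool n} → S a → S b → S c →
                 S (a ⊕ b) → S (a ⊕ c) → S (b ⊕ c) → (a ⊕ b) ⊕ c ≢ 𝟘 →
                 ∃[ w ] S w × S (a ⊕ w) × S (b ⊕ w) × S (c ⊕ w)
clique-extends 4<1+n Sa Sb Sc Sab Sac Sbc abc≢𝟘
  with p , p∈a , p∈b ← common-point Sa Sb Sab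
  with s , p≢s , refl ← star p∈a p∈b Sc Sab Sac Sbc abc≢𝟘
  with q , p≢q , refl ← p∈a
  with r , p≢r , refl ← p∈b
  with t , new ← fresh 4<1+n (p ∷ q ∷ r ∷ s ∷ [])
  = f p ⊕ f t , f-pair (new 0F) , edge q (new 1F) , edge r (new 2F) , edge s (new 3F)
  where
  edge : ∀ x → x ≢ t → S ((f p ⊕ f x) ⊕ (f p ⊕ f t))
  edge x x≢t = subst S (solve (f p ∷ f x ∷ f t ∷ []) (v₁ :+ v₂) ((v₀ :+ v₁) :+ (v₀ :+ v₂)) refl)
                 (f-pair x≢t)

-- A pair meeting all three sides of a triangle contains two of its corners. It is then one of the
-- sides, hence not adjacent to that side.
triangle-maximal : {i j k : Fin (suc n)} {w : Vec Bool n} → i ≢ j → i ≢ k → j ≢ k → S w →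
                   S ((f i ⊕ f j) ⊕ w) → S ((f i ⊕ f k) ⊕ w) → S ((f j ⊕ f k) ⊕ w) → ⊥
triangle-maximal i≢j i≢k j≢k Sw Sij Sik Sjk
  with meets i≢j Sw Sij
... | inj₁ i∈w with meets j≢k Sw Sjk
...   | inj₁ j∈w = S⇒≢ Sij (sym (has-both i≢j i∈w j∈w))
...   | inj₂ k∈w = S⇒≢ Sik (sym (has-both i≢k i∈w k∈w))
triangle-maximal i≢j i≢k j≢k Sw Sij Sik Sjk
    | inj₂ j∈w with meets i≢k Sw Sik
...   | inj₁ i∈w = S⇒≢ Sij (sym (has-both i≢j i∈w j∈w))
...   | inj₂ k∈w = S⇒≢ Sjk (sym (has-both j≢k j∈w k∈w))

-- The index `i` is what the edges to `j` and to `k` have in common, so it can be recovered from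
-- them. With only two indices the swap would satisfy the same equations.
f⊕f-determines : 2 < suc n → (τ : Fin (suc n) → Fin (suc n)) →
                 (∀ i j → f i ⊕ f j ≡ f (τ i) ⊕ f (τ j)) → ∀ i → τ i ≡ i
f⊕f-determines 2<1+n τ eq i
  with j , newⱼ ← fresh (ℕ.<-trans (s≤s (s≤s z≤n)) 2<1+n) (i ∷ [])
  with k , newₖ ← fresh 2<1+n (i ∷ j ∷ [])
  with f⊕f-endpoint {k = τ i} {l = τ j} (newⱼ 0F) (eq i j)
     | f⊕f-endpoint {k = τ i} {l = τ k} (newₖ 0F) (eq i k)
... | inj₁ i≡τi | _         = sym i≡τi
... | inj₂ _    | inj₁ i≡τi = sym i≡τi
... | inj₂ i≡τj | inj₂ i≡τk = contradiction
  (begin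
    f j ⊕ f k            ≡⟨ eq j k ⟩
    f (τ j) ⊕ f (τ k)    ≡⟨ cong₂ (λ s t → f s ⊕ f t) i≡τj i≡τk ⟨
    f i ⊕ f i            ≡⟨ ⊕-self (f i) ⟩
    𝟘                    ∎)
  (λ z → ¬S-𝟘 (subst S z (f-pair (newₖ 1F))))

-- Adjacency in the square of the hypercube.

lookup-injective : {x y : Vec Bool n} → (∀ i → lookup x i ≡ lookup y i) → x ≡ y
lookup-injective {x = x} {y} eq = begin
  x                    ≡⟨ Vec.tabulate∘lookup x ⟨
  tabulate (lookup x)  ≡⟨ Vec.tabulate-cong eq ⟩
  tabulate (lookup y)  ≡⟨ Vec.tabulate∘lookup y ⟩
  y                    ∎

≢⇒xor : {a b : Bool} → a ≢ b → a xor b ≡ true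
≢⇒xor {false} {false} a≢b = contradiction refl a≢b
≢⇒xor {false} {true}  _   = refl
≢⇒xor {true}  {false} _   = refl
≢⇒xor {true}  {true}  a≢b = contradiction refl a≢b

xor⇒≢ : {a b : Bool} → a xor b ≡ true → a ≢ b
xor⇒≢ {a} t refl = true≢false (trans (sym t) (xor-same a))

module _ {n : ℕ} where
  open Graph (Q n) using (_~_)
  open Graph ((Q n) ²) using () renaming (_~_ to _~²_)

  ~⇒⊕≡e : {u v : Vec Bool n} → u ~ v → ∃[ i ] u ⊕ v ≡ e i
  ~⇒⊕≡e {u} {v} (i , uᵢ≢vᵢ , unique) = i , lookup-injective agree
    where
    agree : ∀ j → lookup (u ⊕ v) j ≡ lookup (e i) j
    agree j rewrite Vec.lookup-zipWith _xor_ j u v | lookup-e j i with j ≟ i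
    ... | yes refl = ≢⇒xor uᵢ≢vᵢ
    ... | no j≢i   = trans (cong (_xor lookup v j) uⱼ≡vⱼ) (xor-same (lookup v j))
      where
      uⱼ≡vⱼ : lookup u j ≡ lookup v j
      uⱼ≡vⱼ = decidable-stable (lookup u j Bool.≟ lookup v j) (λ uⱼ≢vⱼ → j≢i (sym (unique uⱼ≢vⱼ)))

  ⊕≡e⇒~ : {u v : Vec Bool n} (i : Fin n) → u ⊕ v ≡ e i → u ~ v
  ⊕≡e⇒~ {u} {v} i eq = i , xor⇒≢ (trans (agree i) (dec-true (i ≟ i) refl)) , unique _
    where
    agree : ∀ j → lookup u j xor lookup v j ≡ does (j ≟ i)
    agree j = begin
      lookup u j xor lookup v j  ≡⟨ Vec.lookup-zipWith _xor_ j u v ⟨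
      lookup (u ⊕ v) j           ≡⟨ cong (λ x → lookup x j) eq ⟩
      lookup (e i) j             ≡⟨ lookup-e j i ⟩
      does (j ≟ i)               ∎
    unique : ∀ j → lookup u j ≢ lookup v j → i ≡ j
    unique j uⱼ≢vⱼ with j ≟ i | agree j
    ... | yes j≡i | _ = sym j≡i
    ... | no _    | b = contradiction (trans (sym (≢⇒xor uⱼ≢vⱼ)) b) true≢false

  -- One step changes `u` by some `e i`, which is the pair of `zero` and `suc i`; two steps change
  -- it by `e i ⊕ e j`, with `i` and `j` distinct because `u` and `v` are.
  ~²⇒S : {u v : Vec Bool n} → u ~² v → S (u ⊕ v)
  ~²⇒S (u≢v , 0 , ([] , _) , _) = contradiction refl u≢v
  ~²⇒S {u} {v} (u≢v , 1 , (u~v ∷ [] , _) , _) with i , eq ← ~⇒⊕≡e {u} {v} u~v =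
    zero , suc i , (λ ()) , trans eq (sym (⊕-identityˡ (e i)))
  ~²⇒S {u} {v} (u≢v , 2 , (_∷_ {v = w} u~w (w~v ∷ []) , _) , _)
    with i , eqᵢ ← ~⇒⊕≡e {u} {w} u~w | j , eqⱼ ← ~⇒⊕≡e {w} {v} w~v
    = suc i , suc j , i≢j , u⊕v
    where
    u⊕v : u ⊕ v ≡ e i ⊕ e j
    u⊕v = trans (solve (u ∷ w ∷ v ∷ []) (v₀ :+ v₂) ((v₀ :+ v₁) :+ (v₁ :+ v₂)) refl)
            (cong₂ _⊕_ eqᵢ eqⱼ)
    i≢j : suc i ≢ suc j
    i≢j refl = u≢v (⊕≡𝟘⇒≡ u v (trans u⊕v (⊕-self (e i))))
  ~²⇒S (_ , suc (suc (suc _)) , _ , s≤s (s≤s ()))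

  adjacent⇒~² : {u v : Vec Bool n} → u ≢ v → u ~ v → u ~² v
  adjacent⇒~² u≢v u~v = u≢v , 1 , (u~v ∷ [] , minimal) , s≤s z≤n
    where
    minimal : ∀ {k} → Walk (Q n) _ _ k → 1 ≤ k
    minimal []      = contradiction refl u≢v
    minimal (_ ∷ _) = s≤s z≤n

  -- A pair containing `zero` is a single basis vector and gives distance one; any other pair gives
  -- distance two, through `u ⊕ e i`.
  S⇒~² : {u v : Vec Bool n} → S (u ⊕ v) → u ~² v
  S⇒~² (zero , zero , i≢j , _) = contradiction refl i≢j
  S⇒~² {u} {v} s@(zero , suc j , _ , eq) =
    adjacent⇒~² (S⇒≢ s) (⊕≡e⇒~ {u} {v} j (trans eq (⊕-identityˡ (e j))))
  S⇒~² {u} {v} s@(suc i , zero , _ , eq) =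
    adjacent⇒~² (S⇒≢ s) (⊕≡e⇒~ {u} {v} i (trans eq (⊕-identityʳ (e i))))
  S⇒~² {u} {v} s@(suc i , suc j , i≢j , eq) =
    S⇒≢ s , 2 , (_∷_ {v = u ⊕ e i} (⊕≡e⇒~ {u} {u ⊕ e i} i u⊕w) (⊕≡e⇒~ {u ⊕ e i} {v} j w⊕v ∷ []) , minimal)
      , s≤s (s≤s z≤n)
    where
    u⊕w : u ⊕ (u ⊕ e i) ≡ e i
    u⊕w = solve (u ∷ e i ∷ []) (v₀ :+ (v₀ :+ v₁)) v₁ refl
    w⊕v : (u ⊕ e i) ⊕ v ≡ e j
    w⊕v = begin
      (u ⊕ e i) ⊕ v        ≡⟨ solve (u ∷ e i ∷ v ∷ []) ((v₀ :+ v₁) :+ v₂) (v₁ :+ (v₀ :+ v₂)) refl ⟩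
      e i ⊕ (u ⊕ v)        ≡⟨ cong (e i ⊕_) eq ⟩
      e i ⊕ (e i ⊕ e j)    ≡⟨ solve (e i ∷ e j ∷ []) (v₀ :+ (v₀ :+ v₁)) v₁ refl ⟩
      e j                  ∎
    minimal : ∀ {k} → Walk (Q n) u v k → 2 ≤ k
    minimal []             = contradiction refl (S⇒≢ s)
    minimal (_ ∷ (_ ∷ _))  = s≤s (s≤s z≤n)
    -- A single step would give `e i ⊕ e j ≡ e k`, forcing both `i` and `j` to equal `k`.
    minimal (u~v ∷ []) with k , eqₖ ← ~⇒⊕≡e {u} {v} u~v =
      contradiction
        (trans (endpoint i≢j ij≡k)
               (sym (endpoint (i≢j ∘ sym) (trans (⊕-comm (e j) (e i)) ij≡k))))
        i≢j
      where
      ij≡k : e i ⊕ e j ≡ f (suc k) ⊕ f zero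
      ij≡k = trans (sym eq) (trans eqₖ (sym (⊕-identityʳ (e k))))
      endpoint : ∀ {i j} → suc i ≢ suc j → e i ⊕ e j ≡ f (suc k) ⊕ f zero → suc i ≡ suc k
      endpoint i≢j eq with f⊕f-endpoint {k = suc k} {l = zero} i≢j eq
      ... | inj₁ i≡k = i≡k

-- Automorphisms are affine.

PreservesEdges : (Vec Bool n ↔ Vec Bool n) → Set
PreservesEdges G = ∀ u v → S (u ⊕ v) ⇔ S (to u ⊕ to v)
  where open Inverse G

-- The linear map with L σ (f i ⊕ f j) = f (σ i) ⊕ f (σ j) for all i and j.
L : (Fin (suc k) → Fin (suc n)) → Vec Bool k → Vec Bool n
L σ = lin (λ i → f (σ (suc i)) ⊕ f (σ zero))

module _ {n : ℕ} (4<1+n : 4 < suc n) (G : Vec Bool n ↔ Vec Bool n) (edges : PreservesEdges G) where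
  open Inverse G using () renaming (to to g; from to g⁻¹)

  private
    g-injective : ∀ {x y} → g x ≡ g y → x ≡ y
    g-injective {x} {y} eq = trans (sym (Inverse.strictlyInverseʳ G x))
                               (trans (cong g⁻¹ eq) (Inverse.strictlyInverseʳ G y))

    A : Vec Bool n → Fin (suc n) → Fin (suc n) → Vec Bool n
    A x i j = g x ⊕ g (x ⊕ (f i ⊕ f j))

    A-edge : ∀ x {i j} → i ≢ j → S (A x i j)
    A-edge x {i} {j} i≢j = Equivalence.to (edges x (x ⊕ (f i ⊕ f j)))
      (subst S (solve (x ∷ f i ⊕ f j ∷ []) v₁ (v₀ :+ (v₀ :+ v₁)) refl) (f-pair {i = i} {j} i≢j))

    A⊕A-edge : ∀ x i j k l → S ((f i ⊕ f j) ⊕ (f k ⊕ f l)) → S (A x i j ⊕ A x k l)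
    A⊕A-edge x i j k l s =
      subst S (solve (g x ∷ g (x ⊕ p) ∷ g (x ⊕ q) ∷ []) (v₁ :+ v₂) ((v₀ :+ v₁) :+ (v₀ :+ v₂)) refl)
        (Equivalence.to (edges (x ⊕ p) (x ⊕ q))
          (subst S (solve (x ∷ p ∷ q ∷ []) (v₁ :+ v₂) ((v₀ :+ v₁) :+ (v₀ :+ v₂)) refl) s))
      where
      p = f i ⊕ f j
      q = f k ⊕ f l

    A-sym : ∀ x i j → A x i j ≡ A x j i
    A-sym x i j = cong (λ y → g x ⊕ g (x ⊕ y)) (⊕-comm (f i) (f j))

    A-refl : ∀ x i → A x i i ≡ 𝟘
    A-refl x i = begin
      g x ⊕ g (x ⊕ (f i ⊕ f i))
        ≡⟨ cong (λ y → g x ⊕ g y) (solve (x ∷ f i ∷ []) (v₀ :+ (v₁ :+ v₁)) v₀ refl) ⟩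
      g x ⊕ g x                  ≡⟨ ⊕-self (g x) ⟩
      𝟘                          ∎

    -- The 4-clique x, x ⊕ f i ⊕ f j, x ⊕ f j ⊕ f k, x ⊕ f i ⊕ f k has no common
    -- neighbour, whereas every 4-clique of nonzero sum has one.
    A-triangle : ∀ x {i j k} → i ≢ j → i ≢ k → j ≢ k → A x i j ⊕ A x j k ≡ A x i k
    A-triangle x {i} {j} {k} i≢j i≢k j≢k with Vec.≡-dec Bool._≟_ ((A x i j ⊕ A x j k) ⊕ A x i k) 𝟘
    ... | yes eq = ⊕≡𝟘⇒≡ _ _ eq
    ... | no ≢𝟘
      with w , Sw , Sij , Sjk , Sik ← clique-extends 4<1+n
        (A-edge x i≢j) (A-edge x j≢k) (A-edge x i≢k)
        (A⊕A-edge x i j j k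
          (subst S (solve (f i ∷ f j ∷ f k ∷ []) (v₀ :+ v₂) ((v₀ :+ v₁) :+ (v₁ :+ v₂)) refl)
            (f-pair {i = i} {k} i≢k)))
        (A⊕A-edge x i j i k
          (subst S (solve (f i ∷ f j ∷ f k ∷ []) (v₁ :+ v₂) ((v₀ :+ v₁) :+ (v₀ :+ v₂)) refl)
            (f-pair {i = j} {k} j≢k)))
        (A⊕A-edge x j k i k
          (subst S (solve (f i ∷ f j ∷ f k ∷ []) (v₁ :+ v₀) ((v₁ :+ v₂) :+ (v₀ :+ v₂)) refl)
            (f-pair {i = j} {i} (i≢j ∘ sym))))
        ≢𝟘
      = contradiction (pullback j k Sjk)
          (triangle-maximal i≢j i≢k j≢k
            (Equivalence.from (edges x (g⁻¹ y)) (subst S centre Sw))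
            (pullback i j Sij) (pullback i k Sik))
      where
      -- A common neighbour of the image clique; its preimage under `g` is a common neighbour of the
      -- original clique of sum zero.
      y : Vec Bool n
      y = g x ⊕ w
      centre : w ≡ g x ⊕ g (g⁻¹ y)
      centre = trans (solve (g x ∷ w ∷ []) v₁ (v₀ :+ (v₀ :+ v₁)) refl)
                 (cong (g x ⊕_) (sym (Inverse.strictlyInverseˡ G y)))
      pullback : ∀ i j → S (A x i j ⊕ w) → S ((f i ⊕ f j) ⊕ (x ⊕ g⁻¹ y))
      pullback i j s =
        subst S (solve (x ∷ f i ⊕ f j ∷ g⁻¹ y ∷ []) ((v₀ :+ v₁) :+ v₂) (v₁ :+ (v₀ :+ v₂)) refl)
          (Equivalence.from (edges (x ⊕ (f i ⊕ f j)) (g⁻¹ y))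
            (subst S (trans
              (solve (g x ∷ g (x ⊕ (f i ⊕ f j)) ∷ w ∷ []) ((v₀ :+ v₁) :+ v₂) (v₁ :+ (v₀ :+ v₂)) refl)
              (cong (g (x ⊕ (f i ⊕ f j)) ⊕_) (sym (Inverse.strictlyInverseˡ G y)))) s))

    A-cocycle : ∀ x i j k → A x i j ⊕ A x j k ≡ A x i k
    A-cocycle x i j k with i ≟ j | j ≟ k | i ≟ k
    ... | yes refl | _ | _ = trans (cong (_⊕ A x i k) (A-refl x i)) (⊕-identityˡ _)
    ... | no _ | yes refl | _ = trans (cong (A x i j ⊕_) (A-refl x j)) (⊕-identityʳ _)
    ... | no _ | no _ | yes refl = begin
      A x i j ⊕ A x j i  ≡⟨ cong (A x i j ⊕_) (A-sym x j i) ⟩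
      A x i j ⊕ A x i j  ≡⟨ ⊕-self _ ⟩
      𝟘                  ≡⟨ A-refl x i ⟨
      A x i i            ∎
    ... | no i≢j | no j≢k | no i≢k = A-triangle x i≢j i≢k j≢k

    -- For edges in a direction `f a ⊕ f i` the index `a` cancels from the endpoint, which becomes
    -- `x ⊕ (f b ⊕ f i)`, so the cocycle law at `x` applies. Other edges split into two of these by
    -- the cocycle law at both base points.
    A-translate : ∀ x a b i j → A (x ⊕ (f a ⊕ f b)) i j ≡ A x i j
    A-translate x a b i j = begin
      A x′ i j              ≡⟨ A-cocycle x′ i a j ⟨
      A x′ i a ⊕ A x′ a j   ≡⟨ cong (_⊕ A x′ a j) (A-sym x′ i a) ⟩
      A x′ a i ⊕ A x′ a j   ≡⟨ cong₂ _⊕_ (from-a i) (from-a j) ⟩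
      A x a i ⊕ A x a j     ≡⟨ cong (_⊕ A x a j) (A-sym x a i) ⟩
      A x i a ⊕ A x a j     ≡⟨ A-cocycle x i a j ⟩
      A x i j               ∎
      where
      x′ = x ⊕ (f a ⊕ f b)
      from-a : ∀ i → A x′ a i ≡ A x a i
      from-a i = begin
        g x′ ⊕ g (x′ ⊕ (f a ⊕ f i))
          ≡⟨ cong (λ y → g x′ ⊕ g y) (solve (x ∷ f a ∷ f b ∷ f i ∷ [])
               ((v₀ :+ (v₁ :+ v₂)) :+ (v₁ :+ v₃)) (v₀ :+ (v₂ :+ v₃)) refl) ⟩
        g x′ ⊕ g (x ⊕ (f b ⊕ f i))
          ≡⟨ solve (g x ∷ g x′ ∷ g (x ⊕ (f b ⊕ f i)) ∷ []) (v₁ :+ v₂) ((v₀ :+ v₁) :+ (v₀ :+ v₂)) refl ⟩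
        A x a b ⊕ A x b i                   ≡⟨ A-cocycle x a b i ⟩
        A x a i                             ∎

    A-constant : ∀ x i j → A x i j ≡ A 𝟘 i j
    A-constant = cube-induction (λ x → ∀ i j → A x i j ≡ A 𝟘 i j) (λ i j → refl)
      (λ x k ih i j → begin
        A (x ⊕ e k) i j          ≡⟨ cong (λ y → A (x ⊕ y) i j) (⊕-identityʳ (e k)) ⟨
        A (x ⊕ (e k ⊕ 𝟘)) i j    ≡⟨ A-translate x (suc k) zero i j ⟩
        A x i j                  ≡⟨ ih i j ⟩
        A 𝟘 i j                  ∎)

    -- The values of the linear part of `g` on the standard basis.
    h : Fin n → Vec Bool n
    h i = A 𝟘 (suc i) zero

    affine : ∀ x → g x ≡ g 𝟘 ⊕ lin h x
    affine = cube-induction (λ x → g x ≡ g 𝟘 ⊕ lin h x)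
      (sym (trans (cong (g 𝟘 ⊕_) (lin-𝟘 h)) (⊕-identityʳ (g 𝟘))))
      (λ x i ih → begin
        g (x ⊕ e i)                ≡⟨ cong (λ y → g (x ⊕ y)) (⊕-identityʳ (e i)) ⟨
        g (x ⊕ (e i ⊕ 𝟘))          ≡⟨ solve (g x ∷ g (x ⊕ (e i ⊕ 𝟘)) ∷ []) v₁ (v₀ :+ (v₀ :+ v₁)) refl ⟩
        g x ⊕ A x (suc i) zero     ≡⟨ cong₂ _⊕_ ih (A-constant x (suc i) zero) ⟩
        g 𝟘 ⊕ lin h x ⊕ h i        ≡⟨ ⊕-assoc _ _ _ ⟩
        g 𝟘 ⊕ (lin h x ⊕ h i)      ≡⟨ cong (λ y → g 𝟘 ⊕ (lin h x ⊕ y)) (lin-e h i) ⟨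
        g 𝟘 ⊕ (lin h x ⊕ lin h (e i)) ≡⟨ cong (g 𝟘 ⊕_) (lin-⊕ h x (e i)) ⟨
        g 𝟘 ⊕ lin h (x ⊕ e i)      ∎)

    h-edge : ∀ i → S (h i)
    h-edge i = A-edge 𝟘 {suc i} {zero} (λ ())

    h⊕h-edge : ∀ {i j} → i ≢ j → S (h i ⊕ h j)
    h⊕h-edge {i} {j} i≢j = A⊕A-edge 𝟘 (suc i) zero (suc j) zero
      (subst S (solve (e i ∷ 𝟘 ∷ e j ∷ []) (v₀ :+ v₂) ((v₀ :+ v₁) :+ (v₂ :+ v₁)) refl)
        (suc i , suc j , (λ { refl → i≢j refl }) , refl))

    -- Otherwise `g` would agree at `e i ⊕ e j` and `e k`, and injectivity would make `suc i` equal
    -- to `suc k` or `zero`.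
    h⊕h⊕h≢𝟘 : ∀ {i j k} → i ≢ j → i ≢ k → (h i ⊕ h j) ⊕ h k ≢ 𝟘
    h⊕h⊕h≢𝟘 {i} {j} {k} i≢j i≢k eq
      with f⊕f-endpoint {i = suc i} {suc j} {suc k} {zero} (λ { refl → i≢j refl })
             (⊕-cancelˡ 𝟘 (g-injective (⊕-cancelˡ (g 𝟘) (begin
               A 𝟘 (suc i) (suc j)                  ≡⟨ A-cocycle 𝟘 (suc i) zero (suc j) ⟨
               h i ⊕ A 𝟘 zero (suc j)               ≡⟨ cong (h i ⊕_) (A-sym 𝟘 zero (suc j)) ⟩
               h i ⊕ h j                            ≡⟨ ⊕≡𝟘⇒≡ _ _ eq ⟩
               h k                                  ∎))))
    ... | inj₁ refl = i≢k refl

    spokes : ∀ {p i₀ i₁} → i₀ ≢ i₁ → Has p (h i₀) → Has p (h i₁) → ∀ i → Has p (h i)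
    spokes {_} {i₀} {i₁} i₀≢i₁ p∈h₀ p∈h₁ i with i₀ ≟ i | i₁ ≟ i
    ... | yes refl | _        = p∈h₀
    ... | no _     | yes refl = p∈h₁
    ... | no i₀≢i  | no i₁≢i  = star p∈h₀ p∈h₁ (h-edge i)
      (h⊕h-edge i₀≢i₁) (h⊕h-edge i₀≢i) (h⊕h-edge i₁≢i) (h⊕h⊕h≢𝟘 i₀≢i₁ i₀≢i)

    two-points : ∀ {m} → 4 < suc m → ∃₂ λ (i j : Fin m) → i ≢ j
    two-points (s≤s (s≤s (s≤s _))) = 0F , 1F , λ ()

    centre : ∃[ p ] (∀ i → Has p (h i))
    centre =
      let i₀ , i₁ , i₀≢i₁ = two-points 4<1+n
          p , p∈h₀ , p∈h₁ = common-point (h-edge i₀) (h-edge i₁) (h⊕h-edge i₀≢i₁)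
      in p , spokes i₀≢i₁ p∈h₀ p∈h₁

    -- The centre of the star is the image of `zero`, and the outer end of the spoke `h i` is the
    -- image of `suc i`. Bijectivity comes later, from the same construction for the inverse of `g`.
    σ : Fin (suc n) → Fin (suc n)
    σ zero    = proj₁ centre
    σ (suc i) = proj₁ (proj₂ centre i)

    h-form : ∀ i → h i ≡ f (σ (suc i)) ⊕ f (σ zero)
    h-form i = trans (proj₂ (proj₂ (proj₂ centre i))) (⊕-comm (f (σ zero)) (f (σ (suc i))))

  affine-form : ∃[ σ ] (∀ x → g x ≡ g 𝟘 ⊕ L σ x)
  affine-form = σ , λ x → trans (affine x) (cong (g 𝟘 ⊕_) (lin-cong h-form x))

-- Linear maps induced by maps of indices.

L-𝟘 : (σ : Fin (suc k) → Fin (suc n)) → L σ 𝟘 ≡ 𝟘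
L-𝟘 {k} σ = lin-𝟘 {k} _

L-⊕ : (σ : Fin (suc k) → Fin (suc n)) (x y : Vec Bool k) → L σ (x ⊕ y) ≡ L σ x ⊕ L σ y
L-⊕ σ = lin-⊕ _

L-cong : {σ τ : Fin (suc k) → Fin (suc n)} → (∀ i → σ i ≡ τ i) → ∀ x → L σ x ≡ L τ x
L-cong σ≈τ = lin-cong (λ i → cong₂ (λ s t → f s ⊕ f t) (σ≈τ (suc i)) (σ≈τ zero))

L-f⊕f : (σ : Fin (suc k) → Fin (suc n)) (i j : Fin (suc k)) → L σ (f i ⊕ f j) ≡ f (σ i) ⊕ f (σ j)
L-f⊕f σ i j = begin
  L σ (f i ⊕ f j)                                          ≡⟨ L-⊕ σ (f i) (f j) ⟩
  L σ (f i) ⊕ L σ (f j)                                    ≡⟨ cong₂ _⊕_ (L-f i) (L-f j) ⟩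
  (f (σ i) ⊕ f (σ zero)) ⊕ (f (σ j) ⊕ f (σ zero))
    ≡⟨ solve (f (σ i) ∷ f (σ j) ∷ f (σ zero) ∷ []) ((v₀ :+ v₂) :+ (v₁ :+ v₂)) (v₀ :+ v₁) refl ⟩
  f (σ i) ⊕ f (σ j)                                        ∎
  where
  L-f : ∀ i → L σ (f i) ≡ f (σ i) ⊕ f (σ zero)
  L-f zero    = trans (L-𝟘 σ) (sym (⊕-self (f (σ zero))))
  L-f (suc i) = lin-e _ i

L-e : (σ : Fin (suc k) → Fin (suc n)) (i : Fin k) → L σ (e i) ≡ f (σ (suc i)) ⊕ f (σ zero)
L-e σ = lin-e _

L-id : (x : Vec Bool n) → L id x ≡ x
L-id = cube-induction (λ x → L id x ≡ x) (L-𝟘 id)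
  (λ x i ih → trans (L-⊕ id x (e i)) (cong₂ _⊕_ ih (trans (L-e id i) (⊕-identityʳ (e i)))))

-- By additivity basis vectors suffice; `L τ` sends each to a sum of two values of `f`, where
-- `L-f⊕f` evaluates `L σ`.
L-∘ : ∀ {m} (σ : Fin (suc k) → Fin (suc n)) (τ : Fin (suc m) → Fin (suc k)) (x : Vec Bool m) →
      L σ (L τ x) ≡ L (σ ∘ τ) x
L-∘ σ τ = cube-induction (λ x → L σ (L τ x) ≡ L (σ ∘ τ) x)
  (trans (cong (L σ) (L-𝟘 τ)) (trans (L-𝟘 σ) (sym (L-𝟘 (σ ∘ τ)))))
  (λ x i ih → begin
    L σ (L τ (x ⊕ e i))                  ≡⟨ cong (L σ) (L-⊕ τ x (e i)) ⟩
    L σ (L τ x ⊕ L τ (e i))              ≡⟨ L-⊕ σ (L τ x) (L τ (e i)) ⟩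
    L σ (L τ x) ⊕ L σ (L τ (e i))        ≡⟨ cong₂ _⊕_ ih (cong (L σ) (L-e τ i)) ⟩
    L (σ ∘ τ) x ⊕ L σ (f (τ (suc i)) ⊕ f (τ zero))
      ≡⟨ cong (L (σ ∘ τ) x ⊕_) (L-f⊕f σ (τ (suc i)) (τ zero)) ⟩
    L (σ ∘ τ) x ⊕ (f (σ (τ (suc i))) ⊕ f (σ (τ zero))) ≡⟨ cong (L (σ ∘ τ) x ⊕_) (L-e (σ ∘ τ) i) ⟨
    L (σ ∘ τ) x ⊕ L (σ ∘ τ) (e i)        ≡⟨ L-⊕ (σ ∘ τ) x (e i) ⟨
    L (σ ∘ τ) (x ⊕ e i)                  ∎)

L≗id⇒≗id : 2 < suc n → (τ : Fin (suc n) → Fin (suc n)) → (∀ x → L τ x ≡ x) → ∀ i → τ i ≡ i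
L≗id⇒≗id 2<1+n τ Lτ≗id =
  f⊕f-determines 2<1+n τ (λ i j → trans (sym (Lτ≗id (f i ⊕ f j))) (L-f⊕f τ i j))

Perm : ℕ → Set
Perm n = Fin (suc n) ↔ Fin (suc n)

open Inverse using (to; from; strictlyInverseˡ; strictlyInverseʳ)

L-inverse : (σ τ : Fin (suc n) → Fin (suc n)) → (∀ i → σ (τ i) ≡ i) → ∀ x → L σ (L τ x) ≡ x
L-inverse σ τ στ x = trans (L-∘ σ τ x) (trans (L-cong στ x) (L-id x))

L-↔ : Perm n → Vec Bool n ↔ Vec Bool n
L-↔ σ = mk↔ₛ′ (L (to σ)) (L (from σ))
  (L-inverse (to σ) (from σ) (strictlyInverseˡ σ))
  (L-inverse (from σ) (to σ) (strictlyInverseʳ σ))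

L-injective : 2 < suc n → (σ τ : Perm n) → (∀ x → L (to σ) x ≡ L (to τ) x) → ∀ i → to σ i ≡ to τ i
L-injective 2<1+n σ τ eq i = begin
  to σ i                    ≡⟨ strictlyInverseˡ τ (to σ i) ⟨
  to τ (from τ (to σ i))    ≡⟨ cong (to τ) (L≗id⇒≗id 2<1+n (from τ ∘ to σ) L≗id i) ⟩
  to τ i                    ∎
  where
  L≗id : ∀ x → L (from τ ∘ to σ) x ≡ x
  L≗id x = begin
    L (from τ ∘ to σ) x      ≡⟨ L-∘ (from τ) (to σ) x ⟨
    L (from τ) (L (to σ) x)  ≡⟨ cong (L (from τ)) (eq x) ⟩
    L (from τ) (L (to τ) x)  ≡⟨ strictlyInverseʳ (L-↔ τ) x ⟩
    x                        ∎

L-S : (σ : Perm n) {x : Vec Bool n} → S x → S (L (to σ) x)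
L-S σ (i , j , i≢j , refl) =
  to σ i , to σ j , (λ eq → i≢j (trans (sym (strictlyInverseʳ σ i))
                             (trans (cong (from σ) eq) (strictlyInverseʳ σ j))))
    , L-f⊕f (to σ) i j

L-edges : (σ : Perm n) → PreservesEdges (L-↔ σ)
L-edges σ u v = mk⇔ (subst S (L-⊕ (to σ) u v) ∘ L-S σ) back
  where
  back : S (L (to σ) u ⊕ L (to σ) v) → S (u ⊕ v)
  back s = subst S (trans (L-⊕ (from σ) (L (to σ) u) (L (to σ) v))
    (cong₂ _⊕_ (strictlyInverseʳ (L-↔ σ) u) (strictlyInverseʳ (L-↔ σ) v))) (L-S (↔-sym σ) s)

-- Translations, and the permutation behind an automorphism.

translation : Vec Bool n → Vec Bool n ↔ Vec Bool n
translation v = mk↔ₛ′ (v ⊕_) (v ⊕_) involutive involutive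
  where
  involutive : ∀ x → v ⊕ (v ⊕ x) ≡ x
  involutive x = solve (v ∷ x ∷ []) (v₀ :+ (v₀ :+ v₁)) v₁ refl

translation-edges : (v : Vec Bool n) → PreservesEdges (translation v)
translation-edges v x y = mk⇔ (subst S eq) (subst S (sym eq))
  where
  eq : x ⊕ y ≡ (v ⊕ x) ⊕ (v ⊕ y)
  eq = solve (v ∷ x ∷ y ∷ []) (v₁ :+ v₂) ((v₀ :+ v₁) :+ (v₀ :+ v₂)) refl

PreservesEdges-sym : (G : Vec Bool n ↔ Vec Bool n) → PreservesEdges G → PreservesEdges (↔-sym G)
PreservesEdges-sym G edges u v =
  mk⇔ (λ s → Equivalence.from (edges (from G u) (from G v)) (subst S (sym G⊕G) s))
      (λ s → subst S G⊕G (Equivalence.to (edges (from G u) (from G v)) s))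
  where
  G⊕G : to G (from G u) ⊕ to G (from G v) ≡ u ⊕ v
  G⊕G = cong₂ _⊕_ (strictlyInverseˡ G u) (strictlyInverseˡ G v)

-- Composing the two affine forms gives `x ≡ c ⊕ L σ (L τ x)`. Taking `x` to be `𝟘` shows that `c`
-- vanishes, so `L (σ ∘ τ)` is the identity and determines `σ ∘ τ`.
affine-inverse : 2 < suc n → (H : Vec Bool n ↔ Vec Bool n) (σ τ : Fin (suc n) → Fin (suc n)) →
               (∀ x → to H x ≡ to H 𝟘 ⊕ L σ x) → (∀ x → from H x ≡ from H 𝟘 ⊕ L τ x) →
               ∀ i → σ (τ i) ≡ i
affine-inverse {n} 2<1+n H σ τ H≗ H⁻¹≗ = L≗id⇒≗id 2<1+n (σ ∘ τ) (λ x → begin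
  L (σ ∘ τ) x              ≡⟨ L-∘ σ τ x ⟨
  L σ (L τ x)              ≡⟨ ⊕-cancelˡ c (trans (sym (expand x)) (sym (c⊕ x))) ⟩
  x                        ∎)
  where
  c : Vec Bool n
  c = to H 𝟘 ⊕ L σ (from H 𝟘)
  expand : ∀ x → x ≡ c ⊕ L σ (L τ x)
  expand x = begin
    x                                            ≡⟨ strictlyInverseˡ H x ⟨
    to H (from H x)                              ≡⟨ H≗ (from H x) ⟩
    to H 𝟘 ⊕ L σ (from H x)                      ≡⟨ cong (λ y → to H 𝟘 ⊕ L σ y) (H⁻¹≗ x) ⟩
    to H 𝟘 ⊕ L σ (from H 𝟘 ⊕ L τ x)              ≡⟨ cong (to H 𝟘 ⊕_) (L-⊕ σ (from H 𝟘) (L τ x)) ⟩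
    to H 𝟘 ⊕ (L σ (from H 𝟘) ⊕ L σ (L τ x))      ≡⟨ ⊕-assoc _ _ _ ⟨
    c ⊕ L σ (L τ x)                              ∎
  c⊕ : ∀ x → c ⊕ x ≡ x
  c⊕ x = trans (cong (_⊕ x) (sym (trans (expand 𝟘) (trans
           (cong (c ⊕_) (trans (cong (L σ) (L-𝟘 τ)) (L-𝟘 σ))) (⊕-identityʳ c)))))
           (⊕-identityˡ x)

-- Abstract because σ is read off a long search that must not be unfolded.
abstract
  affine-permutation : 4 < suc n → (G : Vec Bool n ↔ Vec Bool n) → PreservesEdges G →
                       Σ (Perm n) λ σ → ∀ x → to G x ≡ to G 𝟘 ⊕ L (to σ) x
  affine-permutation {n} 4<1+n G edges =
    mk↔ₛ′ σ τ (affine-inverse 2<1+n G σ τ G≗ G⁻¹≗)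
              (affine-inverse 2<1+n (↔-sym G) τ σ G⁻¹≗ G≗)
    , G≗
    where
    2<1+n : 2 < suc n
    2<1+n = ℕ.<-trans (s≤s (s≤s (s≤s z≤n))) 4<1+n
    σ τ : Fin (suc n) → Fin (suc n)
    σ = proj₁ (affine-form 4<1+n G edges)
    τ = proj₁ (affine-form 4<1+n (↔-sym G) (PreservesEdges-sym G edges))
    G≗ : ∀ x → to G x ≡ to G 𝟘 ⊕ L σ x
    G≗ = proj₂ (affine-form 4<1+n G edges)
    G⁻¹≗ : ∀ x → from G x ≡ from G 𝟘 ⊕ L τ x
    G⁻¹≗ = proj₂ (affine-form 4<1+n (↔-sym G) (PreservesEdges-sym G edges))

-- The two subgroups and the semidirect decomposition.

module _ (n : ℕ) where
  open Group (Aut ((Q n) ²)) using () renaming (Carrier to Automorphism)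

  automorphism : (G : Vec Bool n ↔ Vec Bool n) → PreservesEdges G → Automorphism
  automorphism G edges = G , λ u v →
    mk⇔ (S⇒~² ∘ Equivalence.to (edges u v) ∘ ~²⇒S) (S⇒~² ∘ Equivalence.from (edges u v) ∘ ~²⇒S)

  automorphism-edges : (g : Automorphism) → PreservesEdges (proj₁ g)
  automorphism-edges (_ , adj) u v =
    mk⇔ (~²⇒S ∘ Equivalence.to (adj u v) ∘ S⇒~²) (~²⇒S ∘ Equivalence.from (adj u v) ∘ S⇒~²)

  Translations : Subgroup (Aut ((Q n) ²)) 0ℓ
  Translations = record
    { Member    = λ (G , _) → ∃[ v ] (∀ x → to G x ≡ v ⊕ x)
    ; resp      = λ G≈H (v , G≗) → v , λ x → trans (sym (G≈H x)) (G≗ x)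
    ; ∙-closed  = λ { {G , _} (v , G≗) (w , H≗) → v ⊕ w , λ x →
        trans (trans (cong (to G) (H≗ x)) (G≗ (w ⊕ x))) (sym (⊕-assoc v w x)) }
    ; ε-closed  = 𝟘 , λ x → sym (⊕-identityˡ x)
    ; ⁻¹-closed = λ { {G , _} (v , G≗) → v , λ x → ⊕-cancelˡ v (begin
        v ⊕ from G x      ≡⟨ G≗ (from G x) ⟨
        to G (from G x)   ≡⟨ strictlyInverseˡ G x ⟩
        x                 ≡⟨ solve (v ∷ x ∷ []) v₁ (v₀ :+ (v₀ :+ v₁)) refl ⟩
        v ⊕ (v ⊕ x)       ∎) }
    }

  -- All members fix `𝟘`. Those whose `σ` fixes `zero` permute the coordinates; the others move the
  -- origin within the affine frame `f`.
  Permutations : Subgroup (Aut ((Q n) ²)) 0ℓ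
  Permutations = record
    { Member    = λ (G , _) → Σ (Perm n) λ σ → ∀ x → to G x ≡ L (to σ) x
    ; resp      = λ G≈H (σ , G≗) → σ , λ x → trans (sym (G≈H x)) (G≗ x)
    ; ∙-closed  = λ { {G , _} (σ , G≗) (τ , H≗) → σ ↔-∘ τ , λ x →
        trans (trans (cong (to G) (H≗ x)) (G≗ (L (to τ) x))) (L-∘ (to σ) (to τ) x) }
    ; ε-closed  = ↔-id _ , λ x → sym (L-id x)
    ; ⁻¹-closed = λ { {G , _} (σ , G≗) → ↔-sym σ , λ x → begin
        from G x                               ≡⟨ strictlyInverseʳ (L-↔ σ) (from G x) ⟨
        L (from σ) (L (to σ) (from G x))       ≡⟨ cong (L (from σ)) (G≗ (from G x)) ⟨
        L (from σ) (to G (from G x))           ≡⟨ cong (L (from σ)) (strictlyInverseˡ G x) ⟩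
        L (from σ) x                           ∎ }
    }

  -- The vector is read off the membership witness; this respects equality because it is the image
  -- of `𝟘`.
  Translations≅ℤ₂^n : Subgroup.group Translations ≅ ℤ₂ ^ᴳ n
  Translations≅ℤ₂^n = (λ (_ , v , _) → lookup v) , record
    { isGroupMonomorphism = record
      { isGroupHomomorphism = record
        { isMonoidHomomorphism = record
          { isMagmaHomomorphism = record
            { isRelHomomorphism = record
              { cong = λ { {_ , v , G≗} {_ , w , H≗} G≈H i → cong (λ x → lookup x i) (begin
                  v       ≡⟨ ⊕-identityʳ v ⟨
                  v ⊕ 𝟘   ≡⟨ trans (sym (G≗ 𝟘)) (trans (G≈H 𝟘) (H≗ 𝟘)) ⟩
                  w ⊕ 𝟘   ≡⟨ ⊕-identityʳ w ⟩
                  w       ∎) } }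
            ; homo = λ (_ , v , _) (_ , w , _) i → Vec.lookup-zipWith _xor_ i v w
            }
          ; ε-homo = λ i → Vec.lookup-replicate i false
          }
        ; ⁻¹-homo = λ _ _ → refl
        }
      ; injective = λ { {_ , v , G≗} {_ , w , H≗} v≈w x →
          trans (G≗ x) (trans (cong (_⊕ x) (lookup-injective v≈w)) (sym (H≗ x))) }
      }
    ; surjective = λ c →
        (automorphism (translation (tabulate c)) (translation-edges (tabulate c))
          , tabulate c , λ _ → refl)
        , λ { {_ , v , G≗} G≈T i → trans
            (cong (λ x → lookup x i) (begin
              v               ≡⟨ ⊕-identityʳ v ⟨
              v ⊕ 𝟘           ≡⟨ trans (sym (G≗ 𝟘)) (G≈T 𝟘) ⟩
              tabulate c ⊕ 𝟘  ≡⟨ ⊕-identityʳ (tabulate c) ⟩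
              tabulate c      ∎))
            (Vec.lookup∘tabulate c i) }
    }

  Permutations≅Sym : 2 < suc n → Subgroup.group Permutations ≅ Sym (Fin (suc n))
  Permutations≅Sym 2<1+n = (λ (_ , σ , _) → σ) , record
    { isGroupMonomorphism = record
      { isGroupHomomorphism = record
        { isMonoidHomomorphism = record
          { isMagmaHomomorphism = record
            { isRelHomomorphism = record
              { cong = λ { {_ , σ , G≗} {_ , τ , H≗} G≈H → L-injective 2<1+n σ τ
                  (λ x → trans (sym (G≗ x)) (trans (G≈H x) (H≗ x))) } }
            ; homo = λ _ _ _ → refl
            }
          ; ε-homo = λ _ → refl
          }
        ; ⁻¹-homo = λ _ _ → refl
        }
      ; injective = λ { {_ , σ , G≗} {_ , τ , H≗} σ≈τ x →
          trans (G≗ x) (trans (L-cong σ≈τ x) (sym (H≗ x))) }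
      }
    ; surjective = λ σ →
        (automorphism (L-↔ σ) (L-edges σ) , σ , λ _ → refl)
        , λ { {_ , τ , G≗} G≈L → L-injective 2<1+n τ σ (λ x → trans (sym (G≗ x)) (G≈L x)) }
    }

  semidirect : 4 < suc n → IsSemidirectProduct (Aut ((Q n) ²)) Translations Permutations
  semidirect 4<1+n = record
    { normal  = λ { g@(G , _) {H , _} (v , H≗) → normal G (automorphism-edges g) H v H≗ }
    ; product = λ { g@(G , _) → product G (affine-permutation 4<1+n G (automorphism-edges g)) }
    -- A translation that agrees with a linear map fixes `𝟘`, so its vector is zero.
    ; trivial = λ { {G , _} (v , G≗v) (σ , G≗σ) x → trans (G≗v x)
        (trans (cong (_⊕ x) (begin
          v            ≡⟨ ⊕-identityʳ v ⟨
          v ⊕ 𝟘        ≡⟨ G≗v 𝟘 ⟨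
          to G 𝟘       ≡⟨ G≗σ 𝟘 ⟩
          L (to σ) 𝟘   ≡⟨ L-𝟘 (to σ) ⟩
          𝟘            ∎)) (⊕-identityˡ x)) }
    }
    where
    normal : ∀ G → PreservesEdges G → ∀ H v → (∀ x → to H x ≡ v ⊕ x) →
             ∃[ w ] (∀ x → to G (to H (from G x)) ≡ w ⊕ x)
    -- Conjugation by an affine map acts on a translation vector through the linear part.
    normal G edges H v H≗ with σ , G≗ ← affine-permutation 4<1+n G edges = L (to σ) v , λ x → begin
      to G (to H (from G x))                          ≡⟨ cong (to G) (H≗ (from G x)) ⟩
      to G (v ⊕ from G x)                             ≡⟨ G≗ (v ⊕ from G x) ⟩
      to G 𝟘 ⊕ L (to σ) (v ⊕ from G x)                ≡⟨ cong (to G 𝟘 ⊕_) (L-⊕ (to σ) v (from G x)) ⟩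
      to G 𝟘 ⊕ (L (to σ) v ⊕ L (to σ) (from G x))
        ≡⟨ solve (to G 𝟘 ∷ L (to σ) v ∷ L (to σ) (from G x) ∷ [])
             (v₀ :+ (v₁ :+ v₂)) (v₁ :+ (v₀ :+ v₂)) refl ⟩
      L (to σ) v ⊕ (to G 𝟘 ⊕ L (to σ) (from G x))     ≡⟨ cong (L (to σ) v ⊕_) (G≗ (from G x)) ⟨
      L (to σ) v ⊕ to G (from G x)                    ≡⟨ cong (L (to σ) v ⊕_) (strictlyInverseˡ G x) ⟩
      L (to σ) v ⊕ x                                  ∎
    product : ∀ G → Σ (Perm n) (λ σ → ∀ x → to G x ≡ to G 𝟘 ⊕ L (to σ) x) →
              ∃₂ λ s t → Subgroup.Member Translations s × Subgroup.Member Permutations t ×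
                         (∀ x → to G x ≡ to (proj₁ s) (to (proj₁ t) x))
    -- The affine form itself is the factorisation: first the linear part, then translation by the
    -- image of `𝟘`.
    product G (σ , G≗) =
      automorphism (translation (to G 𝟘)) (translation-edges (to G 𝟘)) ,
      automorphism (L-↔ σ) (L-edges σ) ,
      (to G 𝟘 , λ _ → refl) , (σ , λ _ → refl) , G≗

theorem3p2 : (n : ℕ) → n > 4 → Aut ((Q n) ²) ≅ (ℤ₂ ^ᴳ n) ⋊ Sym (Fin (suc n))
theorem3p2 n n>4 =
  Translations n , Permutations n , semidirect n 4<1+n , Translations≅ℤ₂^n n ,
  Permutations≅Sym n (ℕ.<-trans (s≤s (s≤s (s≤s z≤n))) 4<1+n)
  where
  4<1+n : 4 < suc n
  4<1+n = ℕ.m<n⇒m<1+n n>4
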